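{- For every connected graph $G$ on $n$ vertices, $$k_{\min}(G)\;\geq\;\max\bigl(\mathrm{diam}(G),\ \lceil\log_2 n\rceil\bigr).$$
   Context: Graphs are finite, simple, connected and undirected; $d_G$ is the shortest-path distance and $\mathrm{diam}(G)=\max_{u,v}d_G(u,v)$. For a generating set $S\subseteq\mathbb{Z}_2^k\setminus\{0\}$, $\mathrm{Cay}(\mathbb{Z}_2^k,S)$ is the graph on $\mathbb{Z}_2^k$ with edges $\{g,g+s\}$, $s\in S$. $k_{\min}(G)$ is the least $k$ such that $G$ embeds isometrically (via a distance-preserving map of vertex sets) into $\mathrm{Cay}(\mathbb{Z}_2^k,S)$ for some such $S$. -}

module Defs where

open import Data.Bool using (Bool; true; false; _xor_)
open import Data.Bool.Properties as Bool using (xor-assoc; xor-comm; xor-same; xor-identityˡ; xor-identityʳ)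
open import Data.Empty using (⊥; ⊥-elim)
open import Data.Fin using (Fin; zero; suc)
import Data.Fin.Properties as Fin
open import Data.List using (List; []; _∷_; length; map; filter; allFin; cartesianProductWith)
open import Data.List.Extrema.Nat using (max)
open import Data.List.Membership.Propositional using () renaming (_∈_ to _∈ˡ_)
open import Data.List.Membership.Propositional.Properties using (∈-map⁺; ∈-filter⁺; ∈-filter⁻; ∈-allFin)
open import Data.List.Relation.Unary.All using (All; []; _∷_)
import Data.List.Relation.Unary.All as All
open import Data.List.Relation.Unary.Any using (here; there)
open import Data.Nat using (ℕ; zero; suc; _+_; _^_; _≤_; z≤n; s≤s)
import Data.Nat.Properties as ℕ
open import Data.Product using (Σ; ∃; ∃₂; _×_; _,_; proj₁; proj₂)
open import Data.Product.Function.NonDependent.Propositional using (_×-↔_)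
open import Data.Sum using (_⊎_; inj₁; inj₂)
open import Data.Vec using (Vec; []; _∷_; replicate; zipWith; lookup; tabulate; _[_]≔_)
import Data.Vec.Properties as Vec
open import Function using (_∘_; _↔_; mk↔ₛ′; Inverse)
open import Function.Construct.Composition using (_↔-∘_)
open import Function.Construct.Symmetry using (↔-sym)
open import Level using (Level; 0ℓ)
open import Relation.Binary.PropositionalEquality
open import Relation.Nullary using (¬_; Dec; yes; no; ¬?; contradiction)
open import Relation.Nullary.Decidable using (map′; _×-dec_; _⊎-dec_; does; dec-true; decidable-stable)
open import Relation.Unary using (Pred; Decidable; _∈_; _∉_)

private variable
  ℓ : Level
  A V : Set
  n k : ℕ

IsLeast : (ℕ → Set ℓ) → ℕ → Set ℓ
IsLeast P m = P m × (∀ j → P j → m ≤ j)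

least-exists : {P : ℕ → Set ℓ} → Decidable P → ∃ P → ∃ (IsLeast P)
least-exists {P = P} P? (k , pk) = go P P? k pk
  where
  go : (P : ℕ → Set _) → Decidable P → ∀ k → P k → ∃ (IsLeast P)
  go P P? k pk with P? 0
  go P P? k pk | yes p0 = 0 , p0 , λ _ _ → z≤n
  go P P? zero pk | no ¬p0 = contradiction pk ¬p0
  go P P? (suc k) pk | no ¬p0 with go (P ∘ suc) (P? ∘ suc) k pk
  ... | m , pm , m≤ = suc m , pm , λ where
    zero    p0 → contradiction p0 ¬p0
    (suc j) pj → s≤s (m≤ j pj)

-- The natural number index is the number of edges traversed.  A walk of least
-- length between two vertices is a shortest path.
data Walk (_~_ : V → V → Set) : V → V → ℕ → Set where
  []  : ∀ {u} → Walk _~_ u u 0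
  _∷_ : ∀ {u v w m} → u ~ v → Walk _~_ v w m → Walk _~_ u w (suc m)

-- Finite simple connected undirected graphs on n vertices.  Decidability of
-- adjacency is the constructive content of the graph being a finite object.
record Graph (n : ℕ) : Set₁ where
  infix 4 _~_ _~?_
  field
    Vertex    : Set
    index     : Vertex ↔ Fin n
    _~_       : Vertex → Vertex → Set
    _~?_      : ∀ u v → Dec (u ~ v)
    ~-sym     : ∀ {u v} → u ~ v → v ~ u
    ~-irrefl  : ∀ {u} → ¬ (u ~ u)
    connected : ∀ u v → ∃ (Walk _~_ u v)

  vertices : List Vertex
  vertices = map (Inverse.from index) (allFin n)

search : A ↔ Fin n → {P : Pred A ℓ} → Decidable P → Dec (∃ P)
search A↔n {P} P? =
  map′ (λ (i , p) → from i , p)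
       (λ (a , p) → to a , subst P (sym (strictlyInverseʳ a)) p)
       (Fin.any? (P? ∘ from))
  where open Inverse A↔n

check-all : A ↔ Fin n → {P : Pred A ℓ} → Decidable P → Dec (∀ a → P a)
check-all A↔n P? with search A↔n (¬? ∘ P?)
... | yes (a , ¬p) = no λ all → ¬p (all a)
... | no  ¬∃       = yes λ a → decidable-stable (P? a) λ ¬p → ¬∃ (a , ¬p)

module _ (G : Graph n) where
  open Graph G

  walk? : ∀ u v m → Dec (Walk _~_ u v m)
  walk? u v zero = map′ (λ { refl → [] }) (λ { [] → refl }) (u ≟ v)
    where
    open Inverse index
    index-injective : ∀ {u v} → to u ≡ to v → u ≡ v
    index-injective {u} {v} eq =
      trans (sym (strictlyInverseʳ u)) (trans (cong from eq) (strictlyInverseʳ v))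
    _≟_ : ∀ u v → Dec (u ≡ v)
    u ≟ v = map′ index-injective (cong to) (to u Fin.≟ to v)
  walk? u v (suc m) =
    map′ (λ (w , e , p) → e ∷ p) (λ { (e ∷ p) → _ , e , p })
         (search index (λ w → (u ~? w) ×-dec walk? w v m))

  dist-exists : ∀ u v → ∃ (IsLeast (Walk _~_ u v))
  dist-exists u v = least-exists (walk? u v) (connected u v)

  dist : Vertex → Vertex → ℕ
  dist u v = proj₁ (dist-exists u v)

  -- The default value 0 matters only when n = 0.
  diam : ℕ
  diam = max 0 (cartesianProductWith dist vertices vertices)

IsometricEmbedding : ∀ {m n} → Graph m → Graph n → Set
IsometricEmbedding G H =
  Σ (Graph.Vertex G → Graph.Vertex H) λ f →
    ∀ u v → dist H (f u) (f v) ≡ dist G u v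

ℤ₂^_ : ℕ → Set
ℤ₂^ k = Vec Bool k

𝟎 : ℤ₂^ k
𝟎 = replicate _ false

infixl 6 _⊕_
_⊕_ : ℤ₂^ k → ℤ₂^ k → ℤ₂^ k
_⊕_ = zipWith _xor_

⊕-assoc : (x y z : ℤ₂^ k) → (x ⊕ y) ⊕ z ≡ x ⊕ (y ⊕ z)
⊕-assoc = Vec.zipWith-assoc xor-assoc

⊕-comm : (x y : ℤ₂^ k) → x ⊕ y ≡ y ⊕ x
⊕-comm = Vec.zipWith-comm xor-comm

⊕-identityˡ : (x : ℤ₂^ k) → 𝟎 ⊕ x ≡ x
⊕-identityˡ = Vec.zipWith-identityˡ xor-identityˡ

⊕-identityʳ : (x : ℤ₂^ k) → x ⊕ 𝟎 ≡ x
⊕-identityʳ = Vec.zipWith-identityʳ xor-identityʳ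

⊕-self : (x : ℤ₂^ k) → x ⊕ x ≡ 𝟎
⊕-self []      = refl
⊕-self (b ∷ x) = cong₂ _∷_ (xor-same b) (⊕-self x)

⊕-cancelˡ : (x y : ℤ₂^ k) → x ⊕ (x ⊕ y) ≡ y
⊕-cancelˡ x y = trans (sym (⊕-assoc x x y)) (trans (cong (_⊕ y) (⊕-self x)) (⊕-identityˡ y))

⊕-cancelʳ : (x y : ℤ₂^ k) → (x ⊕ y) ⊕ y ≡ x
⊕-cancelʳ x y = trans (⊕-assoc x y y) (trans (cong (x ⊕_) (⊕-self y)) (⊕-identityʳ x))

⊕-swap : (x y z : ℤ₂^ k) → x ⊕ (y ⊕ z) ≡ y ⊕ (x ⊕ z)
⊕-swap x y z = trans (sym (⊕-assoc x y z)) (trans (cong (_⊕ z) (⊕-comm x y)) (⊕-assoc y x z))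

⊕-telescope : (x y z : ℤ₂^ k) → (x ⊕ y) ⊕ (y ⊕ z) ≡ x ⊕ z
⊕-telescope x y z = trans (⊕-assoc x y (y ⊕ z)) (cong (x ⊕_) (⊕-cancelˡ y z))

ℤ₂^-finite : ∀ k → ℤ₂^ k ↔ Fin (2 ^ k)
ℤ₂^-finite zero    = mk↔ₛ′ (λ _ → zero) (λ _ → []) (λ { zero → refl }) (λ { [] → refl })
ℤ₂^-finite (suc k) =
  ↔-sym (Fin.*↔× {2} {2 ^ k}) ↔-∘ ((↔-sym Fin.2↔Bool ×-↔ ℤ₂^-finite k) ↔-∘ uncons↔)
  where
  uncons↔ : ℤ₂^ suc k ↔ (Bool × ℤ₂^ k)
  uncons↔ = mk↔ₛ′ (λ { (b ∷ x) → b , x }) (λ (b , x) → b ∷ x) (λ _ → refl) (λ { (_ ∷ _) → refl })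

-- The subgroup generated by S.  Every element is its own inverse, so closure
-- under inverses is automatic.
data ⟨_⟩ (S : Pred (ℤ₂^ k) 0ℓ) : Pred (ℤ₂^ k) 0ℓ where
  gen : ∀ {x} → x ∈ S → x ∈ ⟨ S ⟩
  ε   : 𝟎 ∈ ⟨ S ⟩
  _∙_ : ∀ {x y} → x ∈ ⟨ S ⟩ → y ∈ ⟨ S ⟩ → x ⊕ y ∈ ⟨ S ⟩

record GeneratingSet (k : ℕ) : Set₁ where
  field
    S         : Pred (ℤ₂^ k) 0ℓ
    S?        : Decidable S
    𝟎∉S       : 𝟎 ∉ S
    generates : ∀ g → g ∈ ⟨ S ⟩

CayleyAdj : Pred (ℤ₂^ k) 0ℓ → ℤ₂^ k → ℤ₂^ k → Set
CayleyAdj S g h = ∃ λ s → s ∈ S × h ≡ g ⊕ s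

_++ʷ_ : ∀ {_~_ : V → V → Set} {u v w i j} →
        Walk _~_ u v i → Walk _~_ v w j → Walk _~_ u w (i + j)
[]      ++ʷ q = q
(e ∷ p) ++ʷ q = e ∷ (p ++ʷ q)

⟨⟩⇒walk : {S : Pred (ℤ₂^ k) 0ℓ} {x : ℤ₂^ k} → x ∈ ⟨ S ⟩ →
          ∀ g → ∃ (Walk (CayleyAdj S) g (g ⊕ x))
⟨⟩⇒walk (gen s) g = 1 , (_ , s , refl) ∷ []
⟨⟩⇒walk {S = S} ε g = 0 , subst (λ h → Walk (CayleyAdj S) g h 0) (sym (⊕-identityʳ g)) []
⟨⟩⇒walk {S = S} (_∙_ {x} {y} p q) g with ⟨⟩⇒walk p g | ⟨⟩⇒walk q (g ⊕ x)
... | i , u | j , v =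
  i + j , subst (λ h → Walk (CayleyAdj S) g h (i + j)) (⊕-assoc g x y) (u ++ʷ v)

Cay : GeneratingSet k → Graph (2 ^ k)
Cay {k} T = record
  { Vertex    = ℤ₂^ k
  ; index     = ℤ₂^-finite k
  ; _~_       = CayleyAdj S
  ; _~?_      = λ g h → search (ℤ₂^-finite k)
                  (λ s → S? s ×-dec Vec.≡-dec Bool._≟_ h (g ⊕ s))
  ; ~-sym     = λ { {g} (s , s∈S , refl) → s , s∈S , sym (⊕-cancelʳ g s) }
  ; ~-irrefl  = λ { {g} (s , s∈S , g≡g⊕s) →
                  𝟎∉S (subst S (trans (sym (⊕-cancelˡ g s))
                                 (trans (cong (g ⊕_) (sym g≡g⊕s)) (⊕-self g))) s∈S) }
  ; connected = λ g h → subst (λ h′ → ∃ (Walk (CayleyAdj S) g h′)) (⊕-cancelˡ g h)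
                  (⟨⟩⇒walk (generates (g ⊕ h)) g)
  }
  where open GeneratingSet T

EmbedsIn : Graph n → ℕ → Set₁
EmbedsIn G k = Σ (GeneratingSet k) λ S → IsometricEmbedding G (Cay S)

module _ (G : Graph n) where
  open Graph G

  dist-walk : ∀ u v → Walk _~_ u v (dist G u v)
  dist-walk u v = proj₁ (proj₂ (dist-exists G u v))

  dist-≤ : ∀ {u v m} → Walk _~_ u v m → dist G u v ≤ m
  dist-≤ {u} {v} {m} = proj₂ (proj₂ (dist-exists G u v)) m

mapʷ : ∀ {U V : Set} {_~_ : U → U → Set} {_≈_ : V → V → Set} (f : U → V) →
       (∀ {u v} → u ~ v → f u ≈ f v) →
       ∀ {u v m} → Walk _~_ u v m → Walk _≈_ (f u) (f v) m
mapʷ f h []      = []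
mapʷ f h (e ∷ p) = h e ∷ mapʷ f h p

module _ (S T : GeneratingSet k) where
  private
    module S = GeneratingSet S
    module T = GeneratingSet T

  dist-antitone : (∀ {s} → s ∈ S.S → s ∈ T.S) →
                  ∀ g h → dist (Cay T) g h ≤ dist (Cay S) g h
  dist-antitone S⊆T g h = dist-≤ (Cay T)
    (mapʷ (λ x → x) (λ (s , s∈S , eq) → s , S⊆T s∈S , eq) (dist-walk (Cay S) g h))

embedding-resp : (G : Graph n) (S T : GeneratingSet k) →
  (∀ {s} → s ∈ GeneratingSet.S S → s ∈ GeneratingSet.S T) →
  (∀ {s} → s ∈ GeneratingSet.S T → s ∈ GeneratingSet.S S) →
  IsometricEmbedding G (Cay S) → IsometricEmbedding G (Cay T)
embedding-resp G S T S⊆T T⊆S (f , iso) = f , λ u v →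
  trans (ℕ.≤-antisym (dist-antitone S T S⊆T (f u) (f v))
                     (dist-antitone T S T⊆S (f u) (f v)))
        (iso u v)

search-Vec : (∀ {P : Pred A ℓ} → Decidable P → Dec (∃ P)) →
             ∀ n {P : Pred (Vec A n) ℓ} → Decidable P → Dec (∃ P)
search-Vec s zero    P? = map′ (λ p → [] , p) (λ { ([] , p) → p }) (P? [])
search-Vec s (suc n) P? =
  map′ (λ (x , xs , p) → x ∷ xs , p) (λ { (x ∷ xs , p) → x , xs , p })
       (s λ x → search-Vec s n λ xs → P? (x ∷ xs))

embedding? : ∀ {m n} (G : Graph m) (H : Graph n) → Dec (IsometricEmbedding G H)
embedding? {m} G H =
  map′ (λ (fs , iso) → (lookup fs ∘ to) , iso)
       (λ (f , iso) → tabulate (f ∘ from) , λ u v →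
         trans (cong₂ (dist H) (tab f u) (tab f v)) (iso u v))
       (search-Vec (search (Graph.index H)) m λ fs →
         check-all (Graph.index G) λ u → check-all (Graph.index G) λ v →
           dist H (lookup fs (to u)) (lookup fs (to v)) ℕ.≟ dist G u v)
  where
  open Inverse (Graph.index G)
  tab : ∀ f u → lookup (tabulate (f ∘ from)) (to u) ≡ f u
  tab f u = trans (Vec.lookup∘tabulate (f ∘ from) (to u)) (cong f (strictlyInverseʳ u))

-- Sums of sublists of a list, as a decidable description of ⟨ S ⟩.
Span : List (ℤ₂^ k) → Pred (ℤ₂^ k) 0ℓ
Span []      g = g ≡ 𝟎
Span (x ∷ L) g = Span L g ⊎ Span L (x ⊕ g)

span? : (L : List (ℤ₂^ k)) → Decidable (Span L)
span? []      g = Vec.≡-dec Bool._≟_ g 𝟎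
span? (x ∷ L) g = span? L g ⊎-dec span? L (x ⊕ g)

span-𝟎 : (L : List (ℤ₂^ k)) → 𝟎 ∈ Span L
span-𝟎 []      = refl
span-𝟎 (x ∷ L) = inj₁ (span-𝟎 L)

span-⊕ : (L : List (ℤ₂^ k)) → ∀ {g h} → g ∈ Span L → h ∈ Span L → g ⊕ h ∈ Span L
span-⊕ []      refl refl = ⊕-self 𝟎
span-⊕ (x ∷ L) (inj₁ p) (inj₁ q) = inj₁ (span-⊕ L p q)
span-⊕ (x ∷ L) {g} {h} (inj₁ p) (inj₂ q) =
  inj₂ (subst (Span L) (⊕-swap g x h) (span-⊕ L p q))
span-⊕ (x ∷ L) {g} {h} (inj₂ p) (inj₁ q) =
  inj₂ (subst (Span L) (⊕-assoc x g h) (span-⊕ L p q))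
span-⊕ (x ∷ L) {g} {h} (inj₂ p) (inj₂ q) =
  inj₁ (subst (Span L) (trans (cong (_⊕ (x ⊕ h)) (⊕-comm x g)) (⊕-telescope g x h))
         (span-⊕ L p q))

span-∈ : (L : List (ℤ₂^ k)) → ∀ {x} → x ∈ˡ L → x ∈ Span L
span-∈ (x ∷ L) (here refl) = inj₂ (subst (Span L) (sym (⊕-self x)) (span-𝟎 L))
span-∈ (x ∷ L) (there p)   = inj₁ (span-∈ L p)

module _ {S : Pred (ℤ₂^ k) 0ℓ} where

  span⇒⟨⟩ : (L : List (ℤ₂^ k)) → All S L → ∀ {g} → g ∈ Span L → g ∈ ⟨ S ⟩
  span⇒⟨⟩ []      []         refl     = ε
  span⇒⟨⟩ (x ∷ L) (_ ∷ L⊆S)  (inj₁ p) = span⇒⟨⟩ L L⊆S p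
  span⇒⟨⟩ (x ∷ L) (s ∷ L⊆S) {g} (inj₂ p) =
    subst ⟨ S ⟩ (⊕-cancelˡ x g) (gen s ∙ span⇒⟨⟩ L L⊆S p)

  ⟨⟩⇒span : (L : List (ℤ₂^ k)) → (∀ {x} → x ∈ S → x ∈ˡ L) → ∀ {g} → g ∈ ⟨ S ⟩ → g ∈ Span L
  ⟨⟩⇒span L S⊆L (gen s) = span-∈ L (S⊆L s)
  ⟨⟩⇒span L S⊆L ε       = span-𝟎 L
  ⟨⟩⇒span L S⊆L (p ∙ q) = span-⊕ L (⟨⟩⇒span L S⊆L p) (⟨⟩⇒span L S⊆L q)

  ⟨⟩? : Decidable S → Decidable ⟨ S ⟩
  ⟨⟩? S? g = map′ (span⇒⟨⟩ L (All.tabulate λ x∈L → proj₂ (∈-filter⁻ S? {xs = all} x∈L)))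
                  (⟨⟩⇒span L S⊆L) (span? L g)
    where
    open Inverse (ℤ₂^-finite k)
    all L : List (ℤ₂^ k)
    all = map from (allFin (2 ^ k))
    L = filter S? all
    S⊆L : ∀ {x} → x ∈ S → x ∈ˡ L
    S⊆L {x} s = ∈-filter⁺ S?
      (subst (_∈ˡ all) (strictlyInverseʳ x) (∈-map⁺ from (∈-allFin (to x)))) s

⟨⟩-mono : {S T : Pred (ℤ₂^ k) 0ℓ} → (∀ {x} → x ∈ S → x ∈ T) → ∀ {x} → x ∈ ⟨ S ⟩ → x ∈ ⟨ T ⟩
⟨⟩-mono S⊆T (gen s) = gen (S⊆T s)
⟨⟩-mono S⊆T ε       = ε
⟨⟩-mono S⊆T (p ∙ q) = ⟨⟩-mono S⊆T p ∙ ⟨⟩-mono S⊆T q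

-- Subsets of ℤ₂^k are searched through their characteristic vectors.
embedsIn? : (G : Graph n) → Decidable (EmbedsIn G)
embedsIn? G k =
  map′ (λ (t , p , f) → setOf t p , f) code
       (search-Vec (search (↔-sym Fin.2↔Bool)) (2 ^ k) valid-embedding?)
  where
  open Inverse (ℤ₂^-finite k)

  ⟦_⟧ : Vec Bool (2 ^ k) → Pred (ℤ₂^ k) 0ℓ
  ⟦ t ⟧ x = lookup t (to x) ≡ true

  ⟦_⟧? : ∀ t → Decidable ⟦ t ⟧
  ⟦ t ⟧? x = lookup t (to x) Bool.≟ true

  Valid : Vec Bool (2 ^ k) → Set
  Valid t = 𝟎 ∉ ⟦ t ⟧ × (∀ g → g ∈ ⟨ ⟦ t ⟧ ⟩)

  setOf : ∀ t → Valid t → GeneratingSet k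
  setOf t (z , g) = record { S = ⟦ t ⟧ ; S? = ⟦ t ⟧? ; 𝟎∉S = z ; generates = g }

  ValidEmbedding : Vec Bool (2 ^ k) → Set
  ValidEmbedding t = Σ (Valid t) λ p → IsometricEmbedding G (Cay (setOf t p))

  valid-embedding? : Decidable ValidEmbedding
  valid-embedding? t with ¬? (⟦ t ⟧? 𝟎) ×-dec check-all (ℤ₂^-finite k) (⟨⟩? ⟦ t ⟧?)
  ... | no ¬p = no λ (p , _) → ¬p p
  ... | yes p =
    map′ (p ,_)
         (λ (q , f) → embedding-resp G (setOf t q) (setOf t p) (λ x → x) (λ x → x) f)
         (embedding? G (Cay (setOf t p)))

  code : EmbedsIn G k → ∃ ValidEmbedding
  code (T , f) = t , valid , embedding-resp G T (setOf t valid) T⊆t t⊆T f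
    where
    open GeneratingSet T
    t : Vec Bool (2 ^ k)
    t = tabulate (does ∘ S? ∘ from)
    lookup-t : ∀ x → lookup t (to x) ≡ does (S? x)
    lookup-t x = trans (Vec.lookup∘tabulate (does ∘ S? ∘ from) (to x))
                       (cong (does ∘ S?) (strictlyInverseʳ x))
    T⊆t : ∀ {x} → x ∈ S → x ∈ ⟦ t ⟧
    T⊆t {x} s = trans (lookup-t x) (dec-true (S? x) s)
    t⊆T : ∀ {x} → x ∈ ⟦ t ⟧ → x ∈ S
    t⊆T {x} eq with S? x | trans (sym (lookup-t x)) eq
    ... | yes s | _ = s
    ... | no  _ | ()
    valid : Valid t
    valid = 𝟎∉S ∘ t⊆T , ⟨⟩-mono T⊆t ∘ generates

-- Every graph on n ≥ 1 vertices embeds for k = n - 1: send one vertex to 𝟎,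
-- the others to the standard basis, and let S consist of the differences
-- along edges.  An edge can be removed from any expression of vec u ⊕ vec v as
-- a sum of differences so as to move u one step closer to v.

basis : Fin (suc n) → ℤ₂^ n
basis zero    = 𝟎
basis (suc i) = 𝟎 [ i ]≔ true

lookup-𝟎 : (i : Fin n) → lookup 𝟎 i ≢ true
lookup-𝟎 i eq with trans (sym (Vec.lookup-replicate i false)) eq
... | ()

basis-lookup : (i : Fin n) → lookup (basis (suc i)) i ≡ true
basis-lookup i = Vec.lookup∘updateAt i 𝟎

lookup-basis : (a : Fin (suc n)) (i : Fin n) → lookup (basis a) i ≡ true → a ≡ suc i
lookup-basis zero    i eq = contradiction eq (lookup-𝟎 i)
lookup-basis (suc j) i eq with i Fin.≟ j
... | yes refl = refl
... | no i≢j   =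
  contradiction (trans (sym (Vec.lookup∘updateAt′ i j i≢j 𝟎)) eq) (lookup-𝟎 i)

basis-injective : (a b : Fin (suc n)) → basis a ≡ basis b → a ≡ b
basis-injective zero    zero    eq = refl
basis-injective (suc i) b       eq =
  sym (lookup-basis b i (trans (cong (λ x → lookup x i) (sym eq)) (basis-lookup i)))
basis-injective zero    (suc i) eq =
  lookup-basis zero i (trans (cong (λ x → lookup x i) eq) (basis-lookup i))

lookup-⊕-true : (x y : ℤ₂^ k) (i : Fin k) → lookup (x ⊕ y) i ≡ true →
                lookup x i ≡ true ⊎ lookup y i ≡ true
lookup-⊕-true x y i eq =
  xor-true (lookup x i) (lookup y i) (trans (sym (Vec.lookup-zipWith _xor_ i x y)) eq)
  where
  xor-true : ∀ a b → a xor b ≡ true → a ≡ true ⊎ b ≡ true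
  xor-true true  b eq = inj₁ refl
  xor-true false b eq = inj₂ eq

lookup-difference : ∀ i (b : Fin (suc n)) → suc i ≢ b →
                    lookup (basis (suc i) ⊕ basis b) i ≡ true
lookup-difference i b i≢b with lookup (basis b) i in eq
... | true  = contradiction (sym (lookup-basis b i eq)) i≢b
... | false = trans (Vec.lookup-zipWith _xor_ i (basis (suc i)) (basis b))
                    (cong₂ _xor_ (basis-lookup i) eq)

ℤ₂^-spanned : (P : Pred (ℤ₂^ n) 0ℓ) → 𝟎 ∈ P → (∀ {x y} → x ∈ P → y ∈ P → x ⊕ y ∈ P) →
              (∀ a → basis a ∈ P) → ∀ g → g ∈ P
ℤ₂^-spanned {zero}  P p0 p⊕ pb []      = p0
ℤ₂^-spanned {suc n} P p0 p⊕ pb (b ∷ g) =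
  subst P (cong₂ _∷_ (xor-identityʳ b) (⊕-identityˡ g)) (p⊕ (head b) tail)
  where
  head : ∀ b → (b ∷ 𝟎) ∈ P
  head true  = pb (suc zero)
  head false = p0
  tail : (false ∷ g) ∈ P
  tail = ℤ₂^-spanned (λ h → (false ∷ h) ∈ P) p0 p⊕
           (λ { zero → p0 ; (suc i) → pb (suc (suc i)) }) g

module DifferenceSet (G : Graph (suc n)) where
  open Graph G
  open Inverse index

  vec : Vertex → ℤ₂^ n
  vec = basis ∘ to

  vec-injective : ∀ u v → vec u ≡ vec v → u ≡ v
  vec-injective u v eq =
    trans (sym (strictlyInverseʳ u))
          (trans (cong from (basis-injective (to u) (to v) eq)) (strictlyInverseʳ v))

  Difference : Pred (ℤ₂^ n) 0ℓ
  Difference s = ∃₂ λ u v → u ~ v × s ≡ vec u ⊕ vec v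

  walk⇒⟨⟩ : ∀ {u v m} → Walk _~_ u v m → vec u ⊕ vec v ∈ ⟨ Difference ⟩
  walk⇒⟨⟩ {u} [] = subst ⟨ Difference ⟩ (sym (⊕-self (vec u))) ε
  walk⇒⟨⟩ {u} {w} (_∷_ {v = v} e p) =
    subst ⟨ Difference ⟩ (⊕-telescope (vec u) (vec v) (vec w))
      (gen (u , v , e , refl) ∙ walk⇒⟨⟩ p)

  basis∈⟨⟩ : ∀ a → basis a ∈ ⟨ Difference ⟩
  basis∈⟨⟩ a = subst ⟨ Difference ⟩ eq (walk⇒⟨⟩ (proj₂ (connected (from a) (from zero))))
    where
    eq : vec (from a) ⊕ vec (from zero) ≡ basis a
    eq = trans (cong₂ (λ b c → basis b ⊕ basis c) (strictlyInverseˡ a) (strictlyInverseˡ zero))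
               (⊕-identityʳ (basis a))

  differences : GeneratingSet n
  differences = record
    { S         = Difference
    ; S?        = λ s → search index λ u → search index λ v →
                    (u ~? v) ×-dec Vec.≡-dec Bool._≟_ s (vec u ⊕ vec v)
    ; 𝟎∉S       = λ (u , v , e , 𝟎≡) → ~-irrefl (subst (_~ v)
                    (vec-injective u v
                      (trans (sym (⊕-identityʳ (vec u)))
                        (trans (cong (vec u ⊕_) 𝟎≡) (⊕-cancelˡ (vec u) (vec v))))) e)
    ; generates = ℤ₂^-spanned ⟨ Difference ⟩ ε _∙_ basis∈⟨⟩
    }

  Edge : Set
  Edge = ∃₂ _~_

  boundary : List Edge → ℤ₂^ n
  boundary []                = 𝟎
  boundary ((u , v , _) ∷ L) = (vec u ⊕ vec v) ⊕ boundary L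

  walk⇒edges : ∀ {g h m} → Walk (CayleyAdj Difference) g h m →
               ∃ λ L → length L ≡ m × g ⊕ h ≡ boundary L
  walk⇒edges {g} [] = [] , refl , ⊕-self g
  walk⇒edges {g} {h} ((s , (u , v , e , refl) , refl) ∷ p) with walk⇒edges p
  ... | L , len , eq =
    (u , v , e) ∷ L , cong suc len ,
    trans (sym (⊕-cancelˡ s (g ⊕ h)))
      (cong (s ⊕_) (trans (⊕-swap s g h)
        (trans (sym (⊕-assoc g s h)) eq)))

  incident : ∀ w i L → to w ≡ suc i → lookup (boundary L) i ≡ true →
             ∃₂ λ c L′ → w ~ c × length L ≡ suc (length L′) ×
               boundary L ≡ (vec w ⊕ vec c) ⊕ boundary L′
  incident w i [] w≡ eq = contradiction eq (lookup-𝟎 i)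
  incident w i ((u , v , e) ∷ L) w≡ eq with lookup-⊕-true (vec u ⊕ vec v) _ i eq
  incident w i ((u , v , e) ∷ L) w≡ eq | inj₂ q with incident w i L w≡ q
  ... | c , L′ , e′ , len , bd =
    c , (u , v , e) ∷ L′ , e′ , cong suc len ,
    trans (cong ((vec u ⊕ vec v) ⊕_) bd) (⊕-swap (vec u ⊕ vec v) (vec w ⊕ vec c) _)
  incident w i ((u , v , e) ∷ L) w≡ eq | inj₁ q with lookup-⊕-true (vec u) (vec v) i q
  ... | inj₁ r
    with refl ← vec-injective u w (cong basis (trans (lookup-basis (to u) i r) (sym w≡))) =
    v , L , e , refl , refl
  ... | inj₂ r
    with refl ← vec-injective v w (cong basis (trans (lookup-basis (to v) i r) (sym w≡))) =
    u , L , ~-sym e , refl , cong (_⊕ boundary L) (⊕-comm (vec u) (vec v))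

  snoc : ∀ {u v w m} → Walk _~_ u v m → v ~ w → Walk _~_ u w (suc m)
  snoc []      e = e ∷ []
  snoc (d ∷ p) e = d ∷ snoc p e

  reverse : ∀ {u v m} → Walk _~_ u v m → Walk _~_ v u m
  reverse []      = []
  reverse (e ∷ p) = snoc (reverse p) (~-sym e)

  ⊕-remove : (x y z r : ℤ₂^ n) → x ⊕ y ≡ (x ⊕ z) ⊕ r → z ⊕ y ≡ r
  ⊕-remove x y z r eq =
    trans (cong (z ⊕_) (trans (sym (⊕-cancelˡ x y))
            (trans (cong (x ⊕_) (trans eq (⊕-assoc x z r))) (⊕-cancelˡ x (z ⊕ r)))))
          (⊕-cancelˡ z r)

  mutual
    edges⇒walk : ∀ m L u v → length L ≡ m → vec u ⊕ vec v ≡ boundary L →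
                 ∃ λ l → l ≤ m × Walk _~_ u v l
    edges⇒walk m L u v len eq with to u in u≡ | to v in v≡
    ... | suc i | _     = remove m L u v i u≡ len (trans (cong₂ _⊕_ (cong basis u≡) (cong basis v≡)) eq)
    ... | zero  | suc j with remove m L v u j v≡ len (trans (⊕-comm (vec v) (vec u)) (trans (cong₂ _⊕_ (cong basis u≡) (cong basis v≡)) eq))
    ...   | l , l≤m , p = l , l≤m , reverse p
    edges⇒walk m L u v len eq | zero | zero
      with refl ← vec-injective u v (cong basis (trans u≡ (sym v≡))) = 0 , z≤n , []

    remove : ∀ m L u v i → to u ≡ suc i → length L ≡ m → vec u ⊕ vec v ≡ boundary L →
             ∃ λ l → l ≤ m × Walk _~_ u v l
    remove m L u v i u≡ len eq with to u Fin.≟ to v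
    ... | yes u≡v with refl ← vec-injective u v (cong basis u≡v) = 0 , z≤n , []
    ... | no u≢v with incident u i L u≡ (trans (cong (λ x → lookup x i)
                       (trans (sym eq) (cong (λ a → basis a ⊕ vec v) u≡)))
                       (lookup-difference i (to v) (u≢v ∘ trans u≡)))
    remove zero L u v i u≡ len eq | no _ | c , L′ , e , len′ , bd with trans (sym len) len′
    ... | ()
    remove (suc m) L u v i u≡ len eq | no _ | c , L′ , e , len′ , bd
      with edges⇒walk m L′ c v (ℕ.suc-injective (trans (sym len′) len))
             (⊕-remove (vec u) (vec v) (vec c) (boundary L′) (trans eq bd))
    ... | l , l≤m , p = suc l , s≤s l≤m , e ∷ p

  embeds : EmbedsIn G n
  embeds = differences , vec , λ u v → ℕ.≤-antisym (≤-G u v) (G-≤ u v)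
    where
    ≤-G : ∀ u v → dist (Cay differences) (vec u) (vec v) ≤ dist G u v
    ≤-G u v = dist-≤ (Cay differences)
      (mapʷ vec (λ {a} {b} e → _ , (a , b , e , refl) , sym (⊕-cancelˡ (vec a) (vec b)))
            (dist-walk G u v))
    G-≤ : ∀ u v → dist G u v ≤ dist (Cay differences) (vec u) (vec v)
    G-≤ u v with walk⇒edges (dist-walk (Cay differences) (vec u) (vec v))
    ... | L , len , eq with edges⇒walk _ L u v len eq
    ...   | l , l≤m , p = ℕ.≤-trans (dist-≤ G p) l≤m

embeds-somewhere : (G : Graph n) → ∃ (EmbedsIn G)
embeds-somewhere {suc n} G = n , DifferenceSet.embeds G
embeds-somewhere {zero}  G = 0 , trivial , ⊥-elim ∘ no-vertex , λ u → ⊥-elim (no-vertex u)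
  where
  no-vertex : ¬ Graph.Vertex G
  no-vertex u with Inverse.to (Graph.index G) u
  ... | ()
  trivial : GeneratingSet 0
  trivial = record
    { S = λ _ → ⊥ ; S? = λ _ → no λ () ; 𝟎∉S = λ () ; generates = λ { [] → ε } }

kmin-exists : (G : Graph n) → ∃ (IsLeast (EmbedsIn G))
kmin-exists G = least-exists (embedsIn? G) (embeds-somewhere G)

kmin : Graph n → ℕ
kmin G = proj₁ (kmin-exists G)

{-# OPTIONS --safe #-}

-- The d generators along a shortest walk in Cay(ℤ₂^k, S) are linearly
-- independent: a vanishing nonempty subsum could be dropped, giving a shorter
-- walk with the same endpoints.  Hence the 2 ^ d subset sums are distinct and
-- d ≤ k, so isometric copies have diameter at most k.  Isometric embeddings are
-- injective, so also n ≤ 2 ^ k.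
module Submission where

open import Defs
open import Data.Bool using (true; false)
open import Data.Fin using (Fin)
open import Data.Fin.Subset using (Subset; ⊤; ∣_∣)
open import Data.Fin.Subset.Properties using (∣p∣≤n; ∣p∣≡n⇒p≡⊤)
import Data.Fin.Properties as Fin
open import Data.List.Extrema.Nat using (max≤v⁺)
open import Data.List.Relation.Unary.All.Properties using (cartesianProductWith⁺)
open import Data.Nat using (ℕ; z≤n; _⊔_; _^_; _≤_; _≥_)
open import Data.Nat.Logarithm using (⌈log₂_⌉; ⌈log₂⌉-mono-≤; ⌈log₂2^n⌉≡n)
import Data.Nat.Properties as ℕ
open import Data.Product using (∃; _×_; _,_; proj₁; proj₂)
open import Data.Vec using (Vec; []; _∷_)
open import Data.Vec.Relation.Unary.All using (All; []; _∷_)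
open import Function using (_∘_; _↔_; Injective)
open import Function.Construct.Symmetry using (↔-sym)
open import Function.Properties.Inverse using (↔⇒↣)
open import Function.Bundles using (Injection)
open import Level using (0ℓ)
open import Relation.Binary.PropositionalEquality
open import Relation.Unary using (Pred)

private variable
  d k m n : ℕ
  A B : Set

injective⇒≤ : A ↔ Fin m → B ↔ Fin n → {f : A → B} → Injective _≡_ _≡_ f → m ≤ n
injective⇒≤ A↔m B↔n f-injective =
  Fin.injective⇒≤ (Injection.injective (↔⇒↣ (↔-sym A↔m)) ∘ f-injective ∘ Injection.injective (↔⇒↣ B↔n))

-- `⌈log₂_⌉` is monotone and a left inverse of `2 ^_`.
2^-cancel-≤ : 2 ^ m ≤ 2 ^ n → m ≤ n
2^-cancel-≤ {m} {n} = subst₂ _≤_ (⌈log₂2^n⌉≡n m) (⌈log₂2^n⌉≡n n) ∘ ⌈log₂⌉-mono-≤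

-- `Subset d` and `ℤ₂^ d` are both `Vec Bool d`, so `p` doubles as a coefficient vector and `⊕` on
-- subsets is symmetric difference.
subsetSum : Vec (ℤ₂^ k) d → Subset d → ℤ₂^ k
subsetSum []       []          = 𝟎
subsetSum (s ∷ ss) (true  ∷ p) = s ⊕ subsetSum ss p
subsetSum (s ∷ ss) (false ∷ p) = subsetSum ss p

subsetSum-⊕ : (ss : Vec (ℤ₂^ k) d) (p q : Subset d) →
              subsetSum ss (p ⊕ q) ≡ subsetSum ss p ⊕ subsetSum ss q
subsetSum-⊕ []       []          []          = sym (⊕-self 𝟎)
subsetSum-⊕ (s ∷ ss) (false ∷ p) (false ∷ q) = subsetSum-⊕ ss p q
subsetSum-⊕ (s ∷ ss) (true  ∷ p) (false ∷ q) =
  trans (cong (s ⊕_) (subsetSum-⊕ ss p q)) (sym (⊕-assoc s _ _))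
subsetSum-⊕ (s ∷ ss) (false ∷ p) (true  ∷ q) =
  trans (cong (s ⊕_) (subsetSum-⊕ ss p q)) (⊕-swap s _ _)
-- Here `s` drops out of `p ⊕ q`, and its two copies on the right cancel.
subsetSum-⊕ (s ∷ ss) (true  ∷ p) (true  ∷ q) =
  trans (subsetSum-⊕ ss p q)
    (trans (sym (⊕-telescope _ s _)) (cong (_⊕ (s ⊕ subsetSum ss q)) (⊕-comm _ s)))

module _ {S : Pred (ℤ₂^ k) 0ℓ} where

  walk⇒generators : ∀ {g h} → Walk (CayleyAdj S) g h d →
                    ∃ λ ss → All S {d} ss × h ≡ g ⊕ subsetSum ss ⊤
  walk⇒generators [] = [] , [] , sym (⊕-identityʳ _)
  walk⇒generators ((s , s∈S , refl) ∷ p) with walk⇒generators p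
  ... | ss , ss⊆S , eq = s ∷ ss , s∈S ∷ ss⊆S , trans eq (⊕-assoc _ s _)

  -- Only the generators selected by `p` are traversed, so omitting some of them shortens the walk.
  subsetSum-walk : {ss : Vec (ℤ₂^ k) d} → All S ss → ∀ p g →
                   Walk (CayleyAdj S) g (g ⊕ subsetSum ss p) ∣ p ∣
  subsetSum-walk [] [] g =
    subst (λ h → Walk (CayleyAdj S) g h 0) (sym (⊕-identityʳ g)) []
  subsetSum-walk (_ ∷ ss⊆S) (false ∷ p) g = subsetSum-walk ss⊆S p g
  subsetSum-walk {ss = s ∷ ss} (s∈S ∷ ss⊆S) (true ∷ p) g =
    (s , s∈S , refl) ∷
    subst (λ h → Walk (CayleyAdj S) (g ⊕ s) h ∣ p ∣) (⊕-assoc g s (subsetSum ss p))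
      (subsetSum-walk ss⊆S p (g ⊕ s))

⊕-fixed⇒≡ : (x y z : ℤ₂^ k) → z ⊕ (x ⊕ y) ≡ z → x ≡ y
⊕-fixed⇒≡ x y z eq = begin
  x            ≡⟨ ⊕-cancelʳ x y ⟨
  (x ⊕ y) ⊕ y  ≡⟨ cong (_⊕ y) (trans (sym (⊕-cancelˡ z (x ⊕ y))) (trans (cong (z ⊕_) eq) (⊕-self z))) ⟩
  𝟎 ⊕ y        ≡⟨ ⊕-identityˡ y ⟩
  y            ∎
  where open ≡-Reasoning

Cay-dist-≤ : (T : GeneratingSet k) (g h : ℤ₂^ k) → dist (Cay T) g h ≤ k
Cay-dist-≤ {k} T g h with walk⇒generators (dist-walk (Cay T) g h)
-- With `d` the distance, subset sums inject `ℤ₂^ d` into `ℤ₂^ k`, so `2 ^ d ≤ 2 ^ k`.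
... | ss , ss⊆S , h≡ = 2^-cancel-≤ (injective⇒≤ (ℤ₂^-finite _) (ℤ₂^-finite k) sums-injective)
  where
  open GeneratingSet T using (S)

  sums-injective : Injective _≡_ _≡_ (subsetSum ss)
  sums-injective {p} {q} eq = ⊕-fixed⇒≡ p q ⊤ (∣p∣≡n⇒p≡⊤ (ℕ.≤-antisym (∣p∣≤n r) d≤∣r∣))
    where
    open ≡-Reasoning
    -- The complement of the symmetric difference of `p` and `q`. As `p ⊕ q` sums to `𝟎`, passing
    -- from `⊤` to `r` keeps the sum; once `r` is all of `⊤`, `p` and `q` agree.
    r = ⊤ ⊕ (p ⊕ q)

    sum-r : subsetSum ss r ≡ subsetSum ss ⊤
    sum-r = begin
      subsetSum ss r
        ≡⟨ subsetSum-⊕ ss ⊤ (p ⊕ q) ⟩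
      subsetSum ss ⊤ ⊕ subsetSum ss (p ⊕ q)
        ≡⟨ cong (subsetSum ss ⊤ ⊕_) (trans (subsetSum-⊕ ss p q) (cong (_⊕ subsetSum ss q) eq)) ⟩
      subsetSum ss ⊤ ⊕ (subsetSum ss q ⊕ subsetSum ss q)
        ≡⟨ cong (subsetSum ss ⊤ ⊕_) (⊕-self (subsetSum ss q)) ⟩
      subsetSum ss ⊤ ⊕ 𝟎
        ≡⟨ ⊕-identityʳ _ ⟩
      subsetSum ss ⊤ ∎

    -- The generators in `r` also lead from `g` to `h`, so minimality of the distance forbids
    -- omitting any.
    d≤∣r∣ : dist (Cay T) g h ≤ ∣ r ∣
    d≤∣r∣ = dist-≤ (Cay T) (subst (λ h′ → Walk (CayleyAdj S) g h′ ∣ r ∣)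
              (trans (cong (g ⊕_) sum-r) (sym h≡)) (subsetSum-walk ss⊆S r g))

dist≡0⇒≡ : (G : Graph n) → ∀ {u v} → dist G u v ≡ 0 → u ≡ v
dist≡0⇒≡ G {u} {v} eq with [] ← subst (Walk (Graph._~_ G) u v) eq (dist-walk G u v) = refl

dist-self : (G : Graph n) → ∀ u → dist G u u ≡ 0
dist-self G u = ℕ.n≤0⇒n≡0 (dist-≤ G [])

isometric⇒injective : (G : Graph m) (H : Graph n) (φ : IsometricEmbedding G H) →
                      Injective _≡_ _≡_ (proj₁ φ)
isometric⇒injective G H (f , iso) {u} {v} fu≡fv = dist≡0⇒≡ G (begin
  dist G u v          ≡⟨ iso u v ⟨
  dist H (f u) (f v)  ≡⟨ cong (dist H (f u)) fu≡fv ⟨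
  dist H (f u) (f u)  ≡⟨ dist-self H (f u) ⟩
  0                   ∎)
  where open ≡-Reasoning

diam-≤ : (G : Graph n) → (∀ u v → dist G u v ≤ k) → diam G ≤ k
-- `z≤n` bounds the default value 0 of the maximum.
diam-≤ G dist≤k = max≤v⁺ z≤n
  (cartesianProductWith⁺ (setoid Vertex) (setoid Vertex) (dist G) vertices vertices
    λ {u} {v} _ _ → dist≤k u v)
  where open Graph G

embedsIn⇒≤ : (G : Graph n) → EmbedsIn G k → diam G ⊔ ⌈log₂ n ⌉ ≤ k
embedsIn⇒≤ {n} {k} G (T , φ@(f , iso)) = ℕ.⊔-lub
  (diam-≤ G λ u v → subst (_≤ k) (iso u v) (Cay-dist-≤ T (f u) (f v)))
  (subst (⌈log₂ n ⌉ ≤_) (⌈log₂2^n⌉≡n k) (⌈log₂⌉-mono-≤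
    (injective⇒≤ (Graph.index G) (ℤ₂^-finite k) (isometric⇒injective G (Cay T) φ))))

theorem2p35 : ∀ (n : ℕ) (G : Graph n) → kmin G ≥ diam G ⊔ ⌈log₂ n ⌉
-- The bound holds for every `k` admitting an embedding, hence for the least one.
theorem2p35 n G = embedsIn⇒≤ G (proj₁ (proj₂ (kmin-exists G)))
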